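{- For all $n\geq 1$ and $m\geq 2$, \[2\bar{a}_m(n)=\bar{a}_{m-1}(2n,n).\]
   Context: An overpartition of $n$ is a partition of $n$ in which the first occurrence of each distinct part value may be overlined; an overlined part and a non-overlined part of the same value count as equal. $\bar{a}_m(n)$ is the number of overpartitions of $n$ in which the smallest part value occurs at least $m$ times, and $\bar{a}_m(N,\ell)$ is the number of overpartitions of $N$ in which the smallest part value occurs at least $m$ times and the largest part minus the smallest part equals $\ell$. -}

module Defs where

open import Data.Bool.Base using (Bool; true; false)
import Data.Bool.Properties as Bool
open import Data.List.Base
  using (List; []; _∷_; map; length; filter; upTo; concatMap; cartesianProductWith)
open import Data.List.Extrema.Nat using (min; max)
open import Data.List.Membership.Propositional using (_∈_; lose)
open import Data.List.Membership.Propositional.Properties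
  using (∈-filter⁺; ∈-filter⁻; ∈-upTo⁺; ∈-concatMap⁺;
         ∈-cartesianProductWith⁺; ∈-cartesianProductWith⁻)
open import Data.List.Properties using (∷-injective)
open import Data.List.Relation.Binary.Disjoint.Propositional using (Disjoint)
open import Data.List.Relation.Unary.All as All using (All; []; _∷_)
import Data.List.Relation.Unary.All.Properties as All
import Data.List.Relation.Unary.AllPairs as AllPairs
import Data.List.Relation.Unary.AllPairs.Properties as AllPairs
open import Data.List.Relation.Unary.Any using (here; there)
open import Data.List.Relation.Unary.Linked using (Linked; linked?)
open import Data.List.Relation.Unary.Unique.Propositional using (Unique; []; _∷_)
import Data.List.Relation.Unary.Unique.Propositional.Properties as Unique
open import Data.Nat.Base
open import Data.Nat.ListAction using (sum)
open import Data.Nat.Properties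
open import Data.Product.Base using (_×_; _,_; proj₂)
open import Data.Sum.Base using (_⊎_)
open import Relation.Binary.Definitions using () renaming (Decidable to Decidable₂)
open import Relation.Binary.PropositionalEquality
open import Relation.Nullary.Decidable using (map′; _×-dec_; _⊎-dec_)
open import Relation.Unary using (Decidable)

record Part : Set where
  constructor part
  field
    value     : ℕ
    overlined : Bool

open Part public

values : List Part → List ℕ
values = map value

-- Parts are listed in weakly decreasing order of value.  A part equal in value
-- to its predecessor is not the first occurrence of that value, hence cannot
-- be overlined.
_≽_ : Part → Part → Set
p ≽ q = value q < value p ⊎ (value q ≡ value p × overlined q ≡ false)

_≽?_ : Decidable₂ _≽_
p ≽? q = (value q <? value p) ⊎-dec ((value q ≟ value p) ×-dec (overlined q Bool.≟ false))

record IsOverpartition (n : ℕ) (λs : List Part) : Set where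
  constructor isOverpartition
  field
    positive : All (0 <_) (values λs)
    ordered  : Linked _≽_ λs
    total    : sum (values λs) ≡ n

isOverpartition? : ∀ n → Decidable (IsOverpartition n)
isOverpartition? n λs =
  map′ (λ (p , o , t) → isOverpartition p o t)
       (λ (isOverpartition p o t) → p , o , t)
       (All.all? (0 <?_) (values λs) ×-dec linked? _≽?_ λs ×-dec (sum (values λs) ≟ n))

-- An overpartition of n has at most n parts, each of value at most n, so it
-- suffices to filter the finitely many words of length at most n over the
-- parts with values 1, …, n; see ∈-overpartitions⁺, ∈-overpartitions⁻ and
-- overpartitions-unique.
parts : ℕ → List Part
parts n = cartesianProductWith (λ i b → part (suc i) b) (upTo n) (true ∷ false ∷ [])

words : {A : Set} → List A → ℕ → List (List A)
words as zero    = [] ∷ []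
words as (suc k) = cartesianProductWith _∷_ as (words as k)

candidates : ℕ → List (List Part)
candidates n = concatMap (words (parts n)) (upTo (suc n))

overpartitions : ℕ → List (List Part)
overpartitions n = filter (isOverpartition? n) (candidates n)

-- The value 0 at the empty overpartition is a dummy: it is relevant only for
-- overpartitions of 0.
smallest largest : List Part → ℕ
smallest []       = 0
smallest (p ∷ ps) = min (value p) (values ps)
largest []       = 0
largest (p ∷ ps) = max (value p) (values ps)

-- Overlined and plain parts of the same value are counted together.
occurrences : ℕ → List Part → ℕ
occurrences v λs = length (filter (v ≟_) (values λs))

SmallestOccurs≥ : ℕ → List Part → Set
SmallestOccurs≥ m λs = m ≤ occurrences (smallest λs) λs

smallestOccurs≥? : ∀ m → Decidable (SmallestOccurs≥ m)
smallestOccurs≥? m λs = m ≤? occurrences (smallest λs) λs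

-- Truncated subtraction is exact here, as smallest λs ≤ largest λs.
Spread : ℕ → List Part → Set
Spread ℓ λs = largest λs ∸ smallest λs ≡ ℓ

spread? : ∀ ℓ → Decidable (Spread ℓ)
spread? ℓ λs = largest λs ∸ smallest λs ≟ ℓ

ā : (m n : ℕ) → ℕ
ā m n = length (filter (smallestOccurs≥? m) (overpartitions n))

ā-spread : (m N ℓ : ℕ) → ℕ
ā-spread m N ℓ =
  length (filter (λ λs → smallestOccurs≥? m λs ×-dec spread? ℓ λs) (overpartitions N))

private

  ∈-parts : ∀ {n} p → 0 < value p → value p ≤ n → p ∈ parts n
  ∈-parts (part (suc i) b) _ i<n = ∈-cartesianProductWith⁺ _ (∈-upTo⁺ i<n) (∈-bools b)
    where
    ∈-bools : ∀ b → b ∈ true ∷ false ∷ []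
    ∈-bools true  = here refl
    ∈-bools false = there (here refl)

  ∈-words : ∀ {A : Set} {as : List A} {xs} → All (_∈ as) xs → xs ∈ words as (length xs)
  ∈-words []       = here refl
  ∈-words (p ∷ ps) = ∈-cartesianProductWith⁺ _∷_ p (∈-words ps)

  words-length : ∀ {A : Set} (as : List A) k {xs} → xs ∈ words as k → length xs ≡ k
  words-length as zero    (here refl) = refl
  words-length as (suc k) xs∈
    with _ , _ , _ , ys∈ , refl ← ∈-cartesianProductWith⁻ _∷_ as (words as k) xs∈
    = cong suc (words-length as k ys∈)

  words-unique : ∀ {A : Set} {as : List A} → Unique as → ∀ k → Unique (words as k)
  words-unique as! zero    = [] ∷ []
  words-unique as! (suc k) =
    Unique.cartesianProductWith⁺ _∷_ ∷-injective as! (words-unique as! k)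

  parts-unique : ∀ n → Unique (parts n)
  parts-unique n =
    Unique.cartesianProductWith⁺ _ (λ { refl → refl , refl }) (Unique.upTo⁺ n)
      (((λ ()) ∷ []) ∷ [] ∷ [])

  candidates-unique : ∀ n → Unique (candidates n)
  candidates-unique n = Unique.concat⁺
    (All.map⁺ (All.universal (words-unique (parts-unique n)) (upTo (suc n))))
    (AllPairs.map⁺ (AllPairs.map disjoint (Unique.upTo⁺ (suc n))))
    where
    disjoint : ∀ {i j} → i ≢ j → Disjoint (words (parts n) i) (words (parts n) j)
    disjoint {i} {j} i≢j (xs∈i , xs∈j) =
      i≢j (trans (sym (words-length (parts n) i xs∈i)) (words-length (parts n) j xs∈j))

  length≤sum : ∀ λs → All (0 <_) (values λs) → length λs ≤ sum (values λs)
  length≤sum []       []         = z≤n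
  length≤sum (p ∷ ps) (0<p ∷ 0<) = +-mono-≤ 0<p (length≤sum ps 0<)

  all-parts : ∀ {n} λs → All (0 <_) (values λs) → sum (values λs) ≤ n → All (_∈ parts n) λs
  all-parts []       []         _  = []
  all-parts (p ∷ ps) (0<p ∷ 0<) le =
    ∈-parts p 0<p (m+n≤o⇒m≤o (value p) le) ∷ all-parts ps 0< (m+n≤o⇒n≤o (value p) le)

∈-overpartitions⁺ : ∀ {n λs} → IsOverpartition n λs → λs ∈ overpartitions n
∈-overpartitions⁺ {n} {λs} λs⊢n@(isOverpartition 0< _ total) =
  ∈-filter⁺ (isOverpartition? n)
    (∈-concatMap⁺ (words (parts n))
      (lose (∈-upTo⁺ (s≤s (≤-trans (length≤sum λs 0<) (≤-reflexive total))))
            (∈-words (all-parts λs 0< (≤-reflexive total)))))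
    λs⊢n

∈-overpartitions⁻ : ∀ {n λs} → λs ∈ overpartitions n → IsOverpartition n λs
∈-overpartitions⁻ {n} λs∈ = proj₂ (∈-filter⁻ (isOverpartition? n) {xs = candidates n} λs∈)

overpartitions-unique : ∀ n → Unique (overpartitions n)
overpartitions-unique n = Unique.filter⁺ (isOverpartition? n) (candidates-unique n)

-- From an overpartition of n delete one copy of the smallest part s, necessarily
-- plain when s occurs at least twice, and add a part s + n: the total becomes 2n
-- and the spread n.  The parts other than s + n sum to n − s < s + n, so s + n
-- occurs once and may freely be overlined or not, whence the factor 2.
-- Conversely, trade the largest part s + n for a further plain s.
module Submission where

open import Defs
open import Data.Bool.Base using (Bool; true; false)
open import Data.List.Base
  using (List; []; _∷_; _++_; _∷ʳ_; map; length; filter; cartesianProduct; _∷ʳ′_; initLast)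
open import Data.List.Extrema.Nat
  using (argmin-sel; min≤⊤; min≤xs; min≤v⁺; v≤min⁺; ⊥≤max; max≤v⁺)
open import Data.List.Membership.Propositional using (_∈_)
open import Data.List.Membership.Propositional.Properties
  using (∈-map⁺; ∈-map⁻; ∈-++⁺ʳ; ∈-filter⁺; ∈-filter⁻;
         ∈-cartesianProduct⁺; ∈-cartesianProduct⁻)
open import Data.List.Membership.Propositional.Properties.WithK using (unique∧set⇒bag)
open import Data.List.Properties
  using (map-++; map-∘; map-id-local; length-++; length-map; filter-++; filter-accept;
         filter-reject; filter-none)
open import Data.List.Relation.Binary.BagAndSetEquality using (∼bag⇒↭)
open import Data.List.Relation.Binary.Permutation.Propositional.Properties using (↭-length)
open import Data.List.Relation.Unary.All as All using (All; []; _∷_)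
import Data.List.Relation.Unary.All.Properties as All
open import Data.List.Relation.Unary.AllPairs using (AllPairs; []; _∷_)
import Data.List.Relation.Unary.AllPairs.Properties as AllPairs
open import Data.List.Relation.Unary.Any as Any using (here; there)
open import Data.List.Relation.Unary.Linked using (Linked)
open import Data.List.Relation.Unary.Linked.Properties using (AllPairs⇒Linked; Linked⇒AllPairs)
open import Data.List.Relation.Unary.Unique.Propositional using (Unique)
import Data.List.Relation.Unary.Unique.Propositional.Properties as Unique
open import Data.Nat.Base using (ℕ; suc; _+_; _*_; _∸_; _≤_; _<_; z≤n; s≤s; s≤s⁻¹)
open import Data.Nat.ListAction using (sum)
open import Data.Nat.ListAction.Properties using (sum-++)
open import Data.Nat.Properties
open import Data.Nat.Tactic.RingSolver using (solve-∀)
open import Data.Product.Base using (_×_; _,_; proj₁; proj₂; ∃; ∃₂)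
open import Data.Sum.Base using (inj₁; inj₂; map₂)
open import Function.Base using (_∘_; id)
open import Function.Bundles using (mk⇔)
open import Relation.Binary.Definitions using (Transitive)
open import Relation.Binary.PropositionalEquality
open import Relation.Nullary.Decidable using (yes; no; _×-dec_)
open import Relation.Nullary.Negation using (contradiction)

-- Splitting off the last entry of a list, and counting by bijection.

module _ {A : Set} where

  init : List A → List A
  init []           = []
  init (_ ∷ [])     = []
  init (x ∷ y ∷ ys) = x ∷ init (y ∷ ys)

  init-∷ʳ : ∀ xs {x : A} → init (xs ∷ʳ x) ≡ xs
  init-∷ʳ []           = refl
  init-∷ʳ (_ ∷ [])     = refl
  init-∷ʳ (x ∷ y ∷ ys) = cong (x ∷_) (init-∷ʳ (y ∷ ys))

  AllPairs-∷ʳ⁺ : ∀ {R : A → A → Set} {xs x} →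
                 AllPairs R xs → All (λ y → R y x) xs → AllPairs R (xs ∷ʳ x)
  AllPairs-∷ʳ⁺ rs r = AllPairs.++⁺ rs ([] ∷ []) (All.map (_∷ []) r)

  AllPairs-∷ʳ⁻ : ∀ {R : A → A → Set} xs {x} → AllPairs R (xs ∷ʳ x) →
                 AllPairs R xs × All (λ y → R y x) xs
  AllPairs-∷ʳ⁻ []       _        = [] , []
  AllPairs-∷ʳ⁻ (y ∷ ys) (r ∷ rs) =
    let rs′ , r′ = AllPairs-∷ʳ⁻ ys rs
        ry , ryx = All.∷ʳ⁻ r
    in ry ∷ rs′ , ryx ∷ r′

length-cartesianProduct : ∀ {A B : Set} (xs : List A) (ys : List B) →
                          length (cartesianProduct xs ys) ≡ length xs * length ys
length-cartesianProduct []       ys = refl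
length-cartesianProduct (x ∷ xs) ys = begin
  length (map (x ,_) ys ++ cartesianProduct xs ys)
    ≡⟨ length-++ (map (x ,_) ys) ⟩
  length (map (x ,_) ys) + length (cartesianProduct xs ys)
    ≡⟨ cong₂ _+_ (length-map (x ,_) ys) (length-cartesianProduct xs ys) ⟩
  length ys + length xs * length ys ∎
  where open ≡-Reasoning

-- Two lists without repetition and with the same members are permutations of each other; this is
-- applied to `map f xs` and `ys`. The maps need to be mutually inverse only on members of the
-- lists, so their values elsewhere are arbitrary.
length-bijection : ∀ {A B : Set} {xs : List A} {ys : List B} (f : A → B) (g : B → A) →
                   Unique xs → Unique ys →
                   (∀ {x} → x ∈ xs → f x ∈ ys × g (f x) ≡ x) →
                   (∀ {y} → y ∈ ys → g y ∈ xs × f (g y) ≡ y) →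
                   length xs ≡ length ys
length-bijection {xs = xs} {ys} f g xs! ys! f-ok g-ok =
  trans (sym (length-map f xs)) (↭-length (∼bag⇒↭ (unique∧set⇒bag fxs! ys! (mk⇔ to from))))
  where
  g∘f≡id : map g (map f xs) ≡ xs
  g∘f≡id = trans (sym (map-∘ xs)) (map-id-local (All.tabulate (proj₂ ∘ f-ok)))

  -- A repetition in `map f xs` would persist under `g`, which gives back `xs`.
  fxs! : Unique (map f xs)
  fxs! = Unique.map⁻ {f = g} (subst Unique (sym g∘f≡id) xs!)

  to : ∀ {y} → y ∈ map f xs → y ∈ ys
  to y∈ with _ , x∈ , refl ← ∈-map⁻ f y∈ = proj₁ (f-ok x∈)

  from : ∀ {y} → y ∈ ys → y ∈ map f xs
  from y∈ = let gy∈ , fgy≡y = g-ok y∈ in subst (_∈ map f xs) fgy≡y (∈-map⁺ f gy∈)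

-- The order on parts.

≽⇒≥ : ∀ p q → p ≽ q → value q ≤ value p
≽⇒≥ _ _ (inj₁ q<p)       = <⇒≤ q<p
≽⇒≥ _ _ (inj₂ (q≡p , _)) = ≤-reflexive q≡p

≥⇒≽-plain : ∀ p {s} → s ≤ value p → p ≽ part s false
≥⇒≽-plain _ s≤p = map₂ (_, refl) (m≤n⇒m<n∨m≡n s≤p)

-- The condition of being plain bears only on the later part, so it passes unchanged to the
-- composite.
≽-trans : Transitive _≽_
≽-trans {p} {q} p≽q      (inj₁ r<q)              = inj₁ (<-≤-trans r<q (≽⇒≥ p q p≽q))
≽-trans (inj₁ q<p)       (inj₂ (refl , r-plain)) = inj₁ q<p
≽-trans (inj₂ (q≡p , _)) (inj₂ (refl , r-plain)) = inj₂ (q≡p , r-plain)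

-- Turns the order on neighbours into a comparison of the first or the last part with all the others
-- at once.
Linked⇒AllPairs-≽ : ∀ {ps} → Linked _≽_ ps → AllPairs _≽_ ps
Linked⇒AllPairs-≽ = Linked⇒AllPairs (λ {p} {q} {r} → ≽-trans {p} {q} {r})

values-≥ : ∀ {q ps} → All (_≽ q) ps → All (value q ≤_) (values ps)
values-≥ {q} = All.map⁺ ∘ All.map (λ {p} → ≽⇒≥ p q)

values-≤ : ∀ p {qs} → All (p ≽_) qs → All (_≤ value p) (values qs)
values-≤ p = All.map⁺ ∘ All.map (λ {q} → ≽⇒≥ p q)

-- Sums, extreme values and occurrence counts.

values-∷ʳ : ∀ ps p → values (ps ∷ʳ p) ≡ values ps ∷ʳ value p
values-∷ʳ ps p = map-++ value ps (p ∷ [])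

sum-∷ʳ : ∀ ps p → sum (values (ps ∷ʳ p)) ≡ value p + sum (values ps)
sum-∷ʳ ps p = begin
  sum (values (ps ∷ʳ p))             ≡⟨ cong sum (values-∷ʳ ps p) ⟩
  sum (values ps ∷ʳ value p)         ≡⟨ sum-++ (values ps) _ ⟩
  sum (values ps) + (value p + 0)    ≡⟨ +-comm (sum (values ps)) _ ⟩
  value p + 0 + sum (values ps)      ≡⟨ cong (_+ sum (values ps)) (+-identityʳ _) ⟩
  value p + sum (values ps)          ∎
  where open ≡-Reasoning

≤sum : ∀ xs → All (_≤ sum xs) xs
≤sum []       = []
≤sum (x ∷ xs) = m≤m+n x _ ∷ All.map (λ y≤ → ≤-trans y≤ (m≤n+m _ x)) (≤sum xs)

smallest-≡ : ∀ {s} λs → s ∈ values λs → All (s ≤_) (values λs) → smallest λs ≡ s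
smallest-≡ (p ∷ ps) s∈ (s≤p ∷ s≤ps) =
  -- The minimum is seeded with the head, so membership is split into head and tail.
  ≤-antisym (min≤v⁺ _ _ (Any.toSum (Any.map (≤-reflexive ∘ sym) s∈))) (v≤min⁺ s≤p s≤ps)

smallest-≤ : ∀ λs → All (smallest λs ≤_) (values λs)
smallest-≤ []       = []
smallest-≤ (p ∷ ps) = min≤⊤ _ (values ps) ∷ min≤xs _ (values ps)

smallest-∈ : ∀ p ps → smallest (p ∷ ps) ∈ values (p ∷ ps)
smallest-∈ p ps = Any.fromSum (argmin-sel id (value p) (values ps))

smallest-∷ʳ : ∀ {s b} ps → All (s ≤_) (values ps) → smallest (ps ∷ʳ part s b) ≡ s
smallest-∷ʳ {s} {b} ps s≤ = smallest-≡ _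
  (subst (s ∈_) (sym (values-∷ʳ ps _)) (∈-++⁺ʳ (values ps) (here refl)))
  (subst (All (s ≤_)) (sym (values-∷ʳ ps _)) (All.∷ʳ⁺ s≤ ≤-refl))

largest-∷ : ∀ p ps → All (_≤ value p) (values ps) → largest (p ∷ ps) ≡ value p
largest-∷ p ps ps≤p = ≤-antisym (max≤v⁺ ≤-refl ps≤p) (⊥≤max (value p) (values ps))

occurrences⇒∈ : ∀ {v λs} → 1 ≤ occurrences v λs → v ∈ values λs
occurrences⇒∈ {v} {λs} 1≤ with Any.any? (v ≟_) (values λs)
... | yes v∈ = v∈
... | no  v∉ =
  contradiction (cong length (filter-none (v ≟_) (All.¬Any⇒All¬ _ v∉))) (>⇒≢ 1≤)

occurrences-∷-≢ : ∀ {v p ps} → v ≢ value p → occurrences v (p ∷ ps) ≡ occurrences v ps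
occurrences-∷-≢ v≢p = cong length (filter-reject (_ ≟_) v≢p)

occurrences-∷ʳ : ∀ ps p → occurrences (value p) (ps ∷ʳ p) ≡ suc (occurrences (value p) ps)
occurrences-∷ʳ ps p = begin
  length (filter p≟ (values (ps ∷ʳ p)))
    ≡⟨ cong (length ∘ filter p≟) (values-∷ʳ ps p) ⟩
  length (filter p≟ (values ps ∷ʳ value p))
    ≡⟨ cong length (filter-++ p≟ (values ps) _) ⟩
  length (filter p≟ (values ps) ++ filter p≟ (value p ∷ []))
    ≡⟨ cong (λ xs → length (filter p≟ (values ps) ++ xs)) (filter-accept p≟ refl) ⟩
  length (filter p≟ (values ps) ∷ʳ value p)
    ≡⟨ length-++ (filter p≟ (values ps)) ⟩
  occurrences (value p) ps + 1
    ≡⟨ +-comm _ 1 ⟩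
  suc (occurrences (value p) ps) ∎
  where
  open ≡-Reasoning
  p≟ = value p ≟_

-- Arithmetic of the totals n and 2n.

doubled-total : ∀ {n} s t → s + t ≡ n → s + n + t ≡ 2 * n
doubled-total s t refl = identity s t
  where
  identity : ∀ s t → s + (s + t) + t ≡ 2 * (s + t)
  identity = solve-∀

halved-total : ∀ n s t → s + n + t ≡ 2 * n → s + t ≡ n
halved-total n s t eq = +-cancelˡ-≡ n (s + t) n (begin
  n + (s + t)  ≡⟨ identity n s t ⟩
  s + n + t    ≡⟨ eq ⟩
  2 * n        ≡⟨ cong (n +_) (+-identityʳ n) ⟩
  n + n        ∎)
  where
  open ≡-Reasoning
  identity : ∀ n s t → n + (s + t) ≡ s + n + t
  identity = solve-∀

-- The parts common to corresponding overpartitions of n and of 2n.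
record IsCore (m n s : ℕ) (ps : List Part) : Set where
  constructor isCore
  field
    positive : 0 < s
    above    : All (s ≤_) (values ps)
    ordered  : AllPairs _≽_ ps
    enough   : m ≤ occurrences s ps
    total    : s + sum (values ps) ≡ n

-- The lengths of this list and the next are, by definition, `ā m n` and `ā-spread m (2 * n) n`.
repeatedOverpartitions : (m n : ℕ) → List (List Part)
repeatedOverpartitions m n = filter (smallestOccurs≥? m) (overpartitions n)

spreadOverpartitions : (m n : ℕ) → List (List Part)
spreadOverpartitions m n =
  filter (λ λs → smallestOccurs≥? m λs ×-dec spread? n λs) (overpartitions (2 * n))

-- Cores inside the two families of overpartitions.

module _ {k n : ℕ} where

  -- Positive, so that `s` occurs in every core.
  private m = suc k

  core-∈ : ∀ {s ps} → IsCore m n s ps → s ∈ values ps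
  core-∈ {s} {ps} c = occurrences⇒∈ {s} {ps} (≤-trans (s≤s z≤n) (IsCore.enough c))

  core-smallest : ∀ {s ps} → IsCore m n s ps → smallest ps ≡ s
  core-smallest c = smallest-≡ _ (core-∈ c) (IsCore.above c)

  -- No part of the core is below `s`, so a plain `s` may close the list; it raises the count of `s`
  -- by one.
  core⇒repeated : ∀ {s ps} → IsCore m n s ps → ps ∷ʳ part s false ∈ repeatedOverpartitions (suc m) n
  core⇒repeated {s} {ps} (isCore 0<s s≤ps ≽ps enough total) =
    ∈-filter⁺ (smallestOccurs≥? (suc m)) (∈-overpartitions⁺ (isOverpartition
      (subst (All (0 <_)) (sym (values-∷ʳ ps _))
        (All.∷ʳ⁺ (All.map (<-≤-trans 0<s) s≤ps) 0<s))
      (AllPairs⇒Linked (AllPairs-∷ʳ⁺ ≽ps (All.map (λ {p} → ≥⇒≽-plain p) (All.map⁻ s≤ps))))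
      (trans (sum-∷ʳ ps _) total)))
    (subst (λ v → suc m ≤ occurrences v (ps ∷ʳ part s false)) (sym (smallest-∷ʳ ps s≤ps))
      (≤-trans (s≤s enough) (≤-reflexive (sym (occurrences-∷ʳ ps (part s false))))))

  -- The last part of a decreasing list is a smallest one, and removing it costs exactly one
  -- occurrence.
  repeated⇒core : ∀ {λs} → λs ∈ repeatedOverpartitions (suc m) n →
                  ∃₂ λ s ps → λs ≡ ps ∷ʳ part s false × IsCore m n s ps
  repeated⇒core {λs} λs∈
    with λs∈′ , enough ← ∈-filter⁻ (smallestOccurs≥? (suc m)) {xs = overpartitions n} λs∈
    with isOverpartition 0< ≽λs total ← ∈-overpartitions⁻ {n} λs∈′
    with initLast λs
  -- The empty list has no occurrences of anything, whereas `suc m` are demanded.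
  ... | [] = contradiction enough λ ()
  ... | ps ∷ʳ′ p@(part s b) = s , ps , cong (λ b → ps ∷ʳ part s b) b≡false , c
    where
    split = AllPairs-∷ʳ⁻ ps (Linked⇒AllPairs-≽ ≽λs)

    s≤ps : All (s ≤_) (values ps)
    s≤ps = values-≥ (proj₂ split)

    c : IsCore m n s ps
    c = isCore
      (proj₂ (All.∷ʳ⁻ (subst (All (0 <_)) (values-∷ʳ ps p) 0<)))
      s≤ps
      (proj₁ split)
      (s≤s⁻¹ (≤-trans (subst (λ v → suc m ≤ occurrences v (ps ∷ʳ p)) (smallest-∷ʳ ps s≤ps) enough)
                      (≤-reflexive (occurrences-∷ʳ ps p))))
      (trans (sym (sum-∷ʳ ps p)) total)

    -- s also occurs in ps, so p is not its first occurrence.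
    b≡false : b ≡ false
    b≡false with q , q∈ , s≡q ← ∈-map⁻ value (core-∈ c) with All.lookup (proj₂ split) q∈
    ... | inj₁ s<q           = contradiction s≡q (<⇒≢ s<q)
    ... | inj₂ (_ , b≡false) = b≡false

  module _ (0<n : 0 < n) where

    -- Here `0 < n` enters: `s + n` is not a further copy of `s`, so adding or removing it leaves
    -- the count of `s` unchanged.
    s≢s+n : ∀ {s} → s ≢ s + n
    s≢s+n {s} = <⇒≢ (m<m+n s 0<n)

    -- The new part strictly exceeds every part of the core, so it fits in front with either value
    -- of `b`.
    core⇒spread : ∀ {s ps} b → IsCore m n s ps → part (s + n) b ∷ ps ∈ spreadOverpartitions m n
    core⇒spread {s} {ps} b c@(isCore 0<s s≤ps ≽ps enough total) =
      ∈-filter⁺ (λ λs → smallestOccurs≥? m λs ×-dec spread? n λs)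
        (∈-overpartitions⁺ (isOverpartition
          (≤-trans 0<s (m≤m+n s n) ∷ All.map (<-≤-trans 0<s) s≤ps)
          (AllPairs⇒Linked (All.map inj₁ (All.map⁻ ps<s+n) ∷ ≽ps))
          (doubled-total s _ total)))
        ( subst (λ v → m ≤ occurrences v λs) (sym smallest≡s)
            (≤-trans enough (≤-reflexive (sym (occurrences-∷-≢ {s} {part (s + n) b} {ps} s≢s+n))))
        , trans (cong₂ _∸_ (largest-∷ (part (s + n) b) ps (All.map <⇒≤ ps<s+n)) smallest≡s)
                (m+n∸m≡n s n))
      where
      λs = part (s + n) b ∷ ps

      -- The core sums to at most `n`, and `n < s + n` because `s` is positive.
      sum<s+n : sum (values ps) < s + n
      sum<s+n = ≤-<-trans (≤-trans (m≤n+m _ s) (≤-reflexive total)) (m<n+m n 0<s)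

      ps<s+n : All (_< s + n) (values ps)
      ps<s+n = All.map (λ q≤ → ≤-<-trans q≤ sum<s+n) (≤sum (values ps))

      smallest≡s : smallest λs ≡ s
      smallest≡s = smallest-≡ λs (there (core-∈ c)) (m≤m+n s n ∷ s≤ps)

    ∈-spreadOverpartitions⁻ : ∀ {λs} → λs ∈ spreadOverpartitions m n →
                              IsOverpartition (2 * n) λs × SmallestOccurs≥ m λs × Spread n λs
    ∈-spreadOverpartitions⁻ {λs} λs∈
      with λs∈′ , conditions ← ∈-filter⁻ (λ λs → smallestOccurs≥? m λs ×-dec spread? n λs)
                                         {v = λs} {xs = overpartitions (2 * n)} λs∈
      = ∈-overpartitions⁻ λs∈′ , conditions

    -- The first part is the largest, so the spread fixes its value as `s + n`; the tail is the
    -- core.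
    spread⇒core : ∀ {λs} → λs ∈ spreadOverpartitions m n →
                    ∃₂ λ s ps → ∃ λ b → λs ≡ part (s + n) b ∷ ps × IsCore m n s ps
    spread⇒core {[]} λs∈ = contradiction (proj₁ (proj₂ (∈-spreadOverpartitions⁻ λs∈))) λ ()
    spread⇒core {p@(part v b) ∷ ps} λs∈
      with isOverpartition 0< ≽λs total , enough , spread ← ∈-spreadOverpartitions⁻ λs∈
      with p≽ps ∷ ≽ps ← Linked⇒AllPairs-≽ ≽λs
      = s , ps , b , cong (λ v → part v b ∷ ps) v≡s+n , isCore
        (All.lookup 0< (smallest-∈ p ps))
        (All.tail (smallest-≤ (p ∷ ps)))
        ≽ps
        -- The first part is not a copy of `s`, so all occurrences lie in the tail.
        (≤-trans enough (≤-reflexive (occurrences-∷-≢ {s} {p} {ps} λ s≡v → s≢s+n (trans s≡v v≡s+n))))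
        (halved-total n s _ (trans (cong (_+ sum (values ps)) (sym v≡s+n)) total))
      where
      s = smallest (p ∷ ps)

      v≡s+n : v ≡ s + n
      v≡s+n = begin
        -- Truncated subtraction is exact since `s` is at most `v`.
        v                          ≡⟨ m+[n∸m]≡n (All.head (smallest-≤ (p ∷ ps))) ⟨
        s + (v ∸ s)                ≡⟨ cong (λ l → s + (l ∸ s)) (largest-∷ p ps (values-≤ p p≽ps)) ⟨
        s + (largest (p ∷ ps) ∸ s) ≡⟨ cong (s +_) spread ⟩
        s + n                      ∎
        where open ≡-Reasoning

-- The bijection and the count.

widen : ℕ → Bool × List Part → List Part
widen n (b , λs) = part (smallest λs + n) b ∷ init λs

-- The Boolean remembers whether the deleted largest part was overlined. The smallest value is read
-- off the tail, which still contains it when the tail is a core with a positive bound. The value at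
-- the empty list is a dummy.
narrow : List Part → Bool × List Part
narrow []       = true , []
narrow (p ∷ ps) = overlined p , ps ∷ʳ part (smallest ps) false

module _ {k n : ℕ} {s ps} (c : IsCore (suc k) n s ps) where

  -- Once a list is expressed through its core, each map is explicit, and that they invert each
  -- other follows by composing the two equations.
  widen-core : ∀ b → widen n (b , ps ∷ʳ part s false) ≡ part (s + n) b ∷ ps
  widen-core b =
    cong₂ (λ s ps → part (s + n) b ∷ ps) (smallest-∷ʳ ps (IsCore.above c)) (init-∷ʳ ps)

  narrow-core : ∀ b → narrow (part (s + n) b ∷ ps) ≡ (b , ps ∷ʳ part s false)
  narrow-core b = cong (λ s → b , ps ∷ʳ part s false) (core-smallest c)

bools : List Bool
bools = true ∷ false ∷ []

∈-bools : ∀ b → b ∈ bools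
∈-bools true  = here refl
∈-bools false = there (here refl)

bools-unique : Unique bools
bools-unique = ((λ ()) ∷ []) ∷ [] ∷ []

theorem5p3 : ∀ (n m : ℕ) → 1 ≤ n → 2 ≤ m → 2 * ā m n ≡ ā-spread (m ∸ 1) (2 * n) n
theorem5p3 n (suc (suc k)) 0<n (s≤s (s≤s _)) = begin
  2 * length (repeatedOverpartitions (suc m) n)
    -- The factor 2 is `length bools`, the number of ways to mark the part `s + n`.
    ≡⟨ length-cartesianProduct bools (repeatedOverpartitions (suc m) n) ⟨
  length (cartesianProduct bools (repeatedOverpartitions (suc m) n))
    ≡⟨ length-bijection (widen n) narrow (Unique.cartesianProduct⁺ bools-unique repeated-unique)
                        spread-unique widen-ok narrow-ok ⟩
  length (spreadOverpartitions m n) ∎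
  where
  open ≡-Reasoning

  -- One less than the `m` of the statement, and positive because that one is at least 2.
  m = suc k

  repeated-unique : Unique (repeatedOverpartitions (suc m) n)
  repeated-unique = Unique.filter⁺ (smallestOccurs≥? (suc m)) (overpartitions-unique n)

  spread-unique : Unique (spreadOverpartitions m n)
  spread-unique = Unique.filter⁺ (λ λs → smallestOccurs≥? m λs ×-dec spread? n λs)
                                (overpartitions-unique (2 * n))

  widen-ok : ∀ {x} → x ∈ cartesianProduct bools (repeatedOverpartitions (suc m) n) →
             widen n x ∈ spreadOverpartitions m n × narrow (widen n x) ≡ x
  widen-ok {b , λs} x∈
    with _ , λs∈ ← ∈-cartesianProduct⁻ bools (repeatedOverpartitions (suc m) n) x∈
    with s , ps , refl , c ← repeated⇒core {k} {n} λs∈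
    = subst (_∈ spreadOverpartitions m n) (sym (widen-core c b)) (core⇒spread 0<n b c)
    , trans (cong narrow (widen-core c b)) (narrow-core c b)

  narrow-ok : ∀ {y} → y ∈ spreadOverpartitions m n →
              narrow y ∈ cartesianProduct bools (repeatedOverpartitions (suc m) n) × widen n (narrow y) ≡ y
  narrow-ok y∈
    with s , ps , b , refl , c ← spread⇒core {k} {n} 0<n y∈
    = subst (_∈ cartesianProduct bools (repeatedOverpartitions (suc m) n)) (sym (narrow-core c b))
            (∈-cartesianProduct⁺ (∈-bools b) (core⇒repeated c))
    , trans (cong (widen n) (narrow-core c b)) (widen-core c b)
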